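{- Let $(P_n)_{n\ge 0}$ be the Catalan-Larcombe-French numbers. Then for every prime $p$ and all positive integers $m$ and $r$, $$P_{mp^r}\equiv P_{mp^{r-1}}\pmod{p^r}.$$
   Context: The Catalan-Larcombe-French numbers are defined by $P_0=1$, $P_1=8$ and, for $n\ge 2$, $n^2P_n-8(3n^2-3n+1)P_{n-1}+128(n-1)^2P_{n-2}=0$. Equivalently, $P_n=2^n\sum_{i=0}^{\lfloor n/2\rfloor}(-4)^i\binom{2(n-i)}{n-i}^2\binom{n-i}{i}$ for $n\ge 0$. The first values are $1,8,80,896,10816,137728$. -}

module Defs where

open import Data.Nat.Base as ℕ using (ℕ; _∸_)
open import Data.Integer.Base using (ℤ; +_; _+_; _-_; _*_; _^_)
open import Data.Integer.Divisibility.Signed using (_∣_)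
open import Relation.Binary.PropositionalEquality using (_≡_)

-- These conditions determine P, since n² ≠ 0 for n ≥ 2.
record IsCatalanLarcombeFrench (P : ℕ → ℤ) : Set where
  field
    P₀≡1       : P 0 ≡ + 1
    P₁≡8       : P 1 ≡ + 8
    recurrence : ∀ n → 2 ℕ.≤ n →
      (+ n) ^ 2 * P n
        - + 8 * (+ 3 * (+ n) ^ 2 - + 3 * + n + + 1) * P (n ∸ 1)
        + + 128 * (+ n - + 1) ^ 2 * P (n ∸ 2)
      ≡ + 0

infix 4 _≡_[mod_]

_≡_[mod_] : ℤ → ℤ → ℕ → Set
a ≡ b [mod k ] = + k ∣ a - b

{-# OPTIONS --safe #-}

-- With u(j) the constant term of (z + 1/z)^j, that is u(2k) = C(2k, k) and u(j) = 0 for odd j,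
--   P(n) = Σ_j C(n, j) 8^(n-j) 2^j u(j)²,
-- because the right-hand side satisfies the defining recurrence.  Call f a Gauss sequence if
-- f(np) ≡ f(n) mod p^(r+1) whenever the prime p satisfies p^r ∣ n.  Then j ↦ C(2j, j) is one since
-- C(np, kp) ≡ C(n, k) mod p^(r+1), products of Gauss sequences are Gauss, and so is the binomial
-- transform Σ_j C(n, j) f(j) of one: modulo p^(r+1) only the terms of the sum for np with p ∣ j
-- survive, and they match the terms of the sum for n.  Iterating the binomial transform x times
-- gives Σ_j C(n, j) x^(n-j) f(j).

module Submission where

open import Defs
open import Data.Nat.Base as ℕ using (ℕ; zero; suc; z≤n; s≤s; _≤_; _∸_)
open import Data.Nat.Combinatorics using (_C_; nC1≡n; k>n⇒nCk≡0; nCk+nC[k+1]≡[n+1]C[k+1])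
import Data.Nat.Divisibility as ℕ
open import Data.Nat.Primality
  using (Prime; prime⇒nonZero; prime⇒irreducible; prime[2]; ¬prime[1]; euclidsLemma)
import Data.Nat.Properties as ℕ
import Data.Nat.Tactic.RingSolver as ℕSolver
open import Data.Integer.Base using (ℤ; +_; _+_; _-_; _*_; -_; _^_; ∣_∣; -1ℤ)
open import Data.Integer.Divisibility.Signed
open import Data.Integer.Properties
open import Data.Integer.Tactic.RingSolver using (solve-∀)
open import Data.Product.Base using (∃; ∃₂; _×_; _,_; proj₁)
open import Data.Sum.Base using (_⊎_; inj₁; inj₂)
open import Function.Base using (_∘_)
open import Relation.Binary.PropositionalEquality
  using (_≡_; refl; sym; trans; cong; cong₂; subst; subst₂; module ≡-Reasoning)
open import Relation.Nullary using (¬_; yes; no; contradiction)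

-- The binomial transform and its recurrence

-- transform x f n = Σ_j C(n, j) x^(n-j) f(j).
transform : ℕ → (ℕ → ℤ) → ℕ → ℤ
transform x f zero    = f 0
transform x f (suc n) = + x * transform x f n + transform x (f ∘ suc) n

-- The hypothesis is pointwise, so no function extensionality is involved when a summand is
-- rewritten under `transform`.
transform-linear : ∀ x a b {f g h : ℕ → ℤ} → (∀ j → h j ≡ a * f j + b * g j) →
  ∀ n → transform x h n ≡ a * transform x f n + b * transform x g n
transform-linear x a b eq zero = eq 0
transform-linear x a b {f} {g} eq (suc n)
  rewrite transform-linear x a b {f} {g} eq n
        | transform-linear x a b {f ∘ suc} {g ∘ suc} (eq ∘ suc) n =
  rearrange (+ x) a b (transform x f n) (transform x g n) _ _
  where
  rearrange : ∀ x a b u v u′ v′ →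
    x * (a * u + b * v) + (a * u′ + b * v′) ≡ a * (x * u + u′) + b * (x * v + v′)
  rearrange = solve-∀

transform-quadratic : ∀ x a b c {f g h k : ℕ → ℤ} →
  (∀ j → k j ≡ a * f j + b * g j + c * h j) →
  ∀ n → transform x k n ≡ a * transform x f n + b * transform x g n + c * transform x h n
transform-quadratic x a b c {f} {g} {h} {k} eq n = trans
  (transform-linear x (+ 1) c
    (λ j → trans (eq j) (cong (_+ c * h j) (sym (*-identityˡ (a * f j + b * g j))))) n)
  (cong (_+ c * transform x h n)
    (trans (*-identityˡ _) (transform-linear x a b (λ _ → refl) n)))

-- The identity (n - j) C(n, j) = (j + 1) C(n, j + 1), summed against x^(n-j) g(j+1).
transform-shift : ∀ x g n →
  + n * transform x (g ∘ suc) n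
    ≡ transform x (λ j → + j * g (suc j)) n + + x * transform x (λ j → + j * g j) n
transform-shift x g zero = base (+ x)
  where
  base : ∀ x → + 0 ≡ + 0 + x * + 0
  base = solve-∀
transform-shift x g (suc n) = begin
  (+ 1 + + n) * (+ x * E₁ + E₂)
    ≡⟨ expand (+ n) (+ x) E₁ E₂ ⟩
  + x * (+ n * E₁) + + n * E₂ + (+ x * E₁ + E₂)
    ≡⟨ cong₂ (λ u v → + x * u + v + (+ x * E₁ + E₂))
         (transform-shift x g n) (transform-shift x (g ∘ suc) n) ⟩
  + x * (F₁ + + x * F₀) + (F₂ + + x * F₁) + (+ x * E₁ + E₂)
    ≡⟨ collect (+ x) E₁ E₂ F₀ F₁ F₂ ⟩
  + x * F₁ + (+ 1 * E₂ + + 1 * F₂) + + x * (+ x * F₀ + (+ 1 * E₁ + + 1 * F₁))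
    ≡⟨ cong₂ (λ u v → + x * F₁ + u + + x * (+ x * F₀ + v))
         (transform-linear x (+ 1) (+ 1) (λ j → split (+ j) (g (suc (suc j)))) n)
         (transform-linear x (+ 1) (+ 1) (λ j → split (+ j) (g (suc j))) n) ⟨
  + x * F₁ + transform x (λ j → + suc j * g (suc (suc j))) n
    + + x * (+ x * F₀ + transform x (λ j → + suc j * g (suc j)) n) ∎
  where
  open ≡-Reasoning
  E₁ E₂ F₀ F₁ F₂ : ℤ
  E₁ = transform x (g ∘ suc) n
  E₂ = transform x (g ∘ suc ∘ suc) n
  F₀ = transform x (λ j → + j * g j) n
  F₁ = transform x (λ j → + j * g (suc j)) n
  F₂ = transform x (λ j → + j * g (suc (suc j))) n
  expand : ∀ n x e₁ e₂ →
    (+ 1 + n) * (x * e₁ + e₂) ≡ x * (n * e₁) + n * e₂ + (x * e₁ + e₂)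
  expand = solve-∀
  collect : ∀ x e₁ e₂ f₀ f₁ f₂ →
    x * (f₁ + x * f₀) + (f₂ + x * f₁) + (x * e₁ + e₂)
      ≡ x * f₁ + (+ 1 * e₂ + + 1 * f₂) + x * (x * f₀ + (+ 1 * e₁ + + 1 * f₁))
  collect = solve-∀
  split : ∀ j y → (+ 1 + j) * y ≡ + 1 * y + + 1 * (j * y)
  split = solve-∀

-- Expanding transform x a at n + 1 and n + 2 in terms of shifts of a at n, the claim is a linear
-- combination (`combination`) of instances of transform-shift and the hypothesis on a.
transform-recurrence : ∀ x (a : ℕ → ℤ) → a 1 ≡ + 0 →
  (∀ j → ((+ 2 + + j) * (+ 2 + + j)) * a (2 ℕ.+ j) ≡ ((+ x * (+ 1 + + j)) * (+ x * (+ 1 + + j))) * a j) →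
  ∀ n → ((+ 2 + + n) * (+ 2 + + n)) * transform x a (2 ℕ.+ n)
        - + x * (+ 3 * ((+ 2 + + n) * (+ 2 + + n)) - + 3 * (+ 2 + + n) + + 1) * transform x a (1 ℕ.+ n)
        + + 2 * (+ x * + x) * ((+ 1 + + n) * (+ 1 + + n)) * transform x a n
      ≡ + 0
transform-recurrence x a a₁≡0 rec n = begin
  ((+ 2 + N) * (+ 2 + N)) * (X * (X * a₀ + b₀) + (X * b₀ + c₀))
      - X * (+ 3 * ((+ 2 + N) * (+ 2 + N)) - + 3 * (+ 2 + N) + + 1) * (X * a₀ + b₀)
      + + 2 * (X * X) * ((+ 1 + N) * (+ 1 + N)) * a₀
    ≡⟨ combination N X a₀ a₁ a₂ b₀ b₁ b₂ c₀ c₁ c₂ d ⟩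
  combine (N * c₀ - (c₁ + X * b₁))
    (N * (+ 1 * c₁ + + 2 * c₀) - ((+ 1 * c₂ + + 2 * c₁) + X * (+ 1 * b₂ + + 1 * b₁)))
    (N * b₀ - (b₁ + X * a₁))
    (N * (+ 1 * a₁ + + 1 * a₀) - ((+ 1 * a₂ + + 1 * a₁) + X * d))
    ((+ 1 * c₂ + + 4 * c₁ + + 4 * c₀) - ((X * X) * a₂ + + 2 * (X * X) * a₁ + (X * X) * a₀))
    ((X * X) * d - (+ 1 * b₂ + + 2 * b₁ + + 1 * b₀))
    ≡⟨ combine-cong (i≡j⇒i-j≡0 r₁) (i≡j⇒i-j≡0 r₂) (i≡j⇒i-j≡0 r₃)
         (i≡j⇒i-j≡0 r₄) (i≡j⇒i-j≡0 r₅) (i≡j⇒i-j≡0 r₆) ⟩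
  combine (+ 0) (+ 0) (+ 0) (+ 0) (+ 0) (+ 0)
    ≡⟨ vanish N X ⟩
  + 0 ∎
  where
  open ≡-Reasoning
  N X : ℤ
  N = + n
  X = + x
  E : (ℕ → ℤ) → ℤ
  E f = transform x f n
  -- `h` is j · a(j-1) with value 0 at j = 0, so that `h ∘ suc` is (j+1) · a(j) and
  -- `transform-shift` applies to it.
  h : ℕ → ℤ
  h zero    = + 0
  h (suc j) = + suc j * a j
  a₀ = E a
  a₁ = E (λ j → + j * a j)
  a₂ = E (λ j → + j * (+ j * a j))
  b₀ = E (λ j → a (1 ℕ.+ j))
  b₁ = E (λ j → + j * a (1 ℕ.+ j))
  b₂ = E (λ j → + j * (+ j * a (1 ℕ.+ j)))
  c₀ = E (λ j → a (2 ℕ.+ j))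
  c₁ = E (λ j → + j * a (2 ℕ.+ j))
  c₂ = E (λ j → + j * (+ j * a (2 ℕ.+ j)))
  d = E (λ j → + j * h j)

  r₁ : N * c₀ ≡ c₁ + X * b₁
  r₁ = transform-shift x (λ j → a (1 ℕ.+ j)) n

  r₂ : N * (+ 1 * c₁ + + 2 * c₀) ≡ (+ 1 * c₂ + + 2 * c₁) + X * (+ 1 * b₂ + + 1 * b₁)
  r₂ = begin
    N * (+ 1 * c₁ + + 2 * c₀)
      ≡⟨ cong (N *_) (transform-linear x (+ 1) (+ 2) (λ j → by-2 (+ j) (a (2 ℕ.+ j))) n) ⟨
    N * E (λ j → + (2 ℕ.+ j) * a (2 ℕ.+ j))
      ≡⟨ transform-shift x (λ j → + (1 ℕ.+ j) * a (1 ℕ.+ j)) n ⟩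
    E (λ j → + j * (+ (2 ℕ.+ j) * a (2 ℕ.+ j))) + X * E (λ j → + j * (+ (1 ℕ.+ j) * a (1 ℕ.+ j)))
      ≡⟨ cong₂ (λ u v → u + X * v)
           (transform-linear x (+ 1) (+ 2) (λ j → by-2′ (+ j) (a (2 ℕ.+ j))) n)
           (transform-linear x (+ 1) (+ 1) (λ j → by-1′ (+ j) (a (1 ℕ.+ j))) n) ⟩
    (+ 1 * c₂ + + 2 * c₁) + X * (+ 1 * b₂ + + 1 * b₁) ∎
    where
    by-2 : ∀ j y → (+ 2 + j) * y ≡ + 1 * (j * y) + + 2 * y
    by-2 = solve-∀
    by-2′ : ∀ j y → j * ((+ 2 + j) * y) ≡ + 1 * (j * (j * y)) + + 2 * (j * y)
    by-2′ = solve-∀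
    by-1′ : ∀ j y → j * ((+ 1 + j) * y) ≡ + 1 * (j * (j * y)) + + 1 * (j * y)
    by-1′ = solve-∀

  r₃ : N * b₀ ≡ b₁ + X * a₁
  r₃ = transform-shift x a n

  r₄ : N * (+ 1 * a₁ + + 1 * a₀) ≡ (+ 1 * a₂ + + 1 * a₁) + X * d
  r₄ = begin
    N * (+ 1 * a₁ + + 1 * a₀)
      ≡⟨ cong (N *_) (transform-linear x (+ 1) (+ 1) (λ j → by-1 (+ j) (a j)) n) ⟨
    N * E (h ∘ suc)
      ≡⟨ transform-shift x h n ⟩
    E (λ j → + j * h (suc j)) + X * d
      ≡⟨ cong (_+ X * d) (transform-linear x (+ 1) (+ 1) (λ j → by-1′ (+ j) (a j)) n) ⟩
    (+ 1 * a₂ + + 1 * a₁) + X * d ∎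
    where
    by-1 : ∀ j y → (+ 1 + j) * y ≡ + 1 * (j * y) + + 1 * y
    by-1 = solve-∀
    by-1′ : ∀ j y → j * ((+ 1 + j) * y) ≡ + 1 * (j * (j * y)) + + 1 * (j * y)
    by-1′ = solve-∀

  -- The hypothesis on `a`, expanded in powers of j on both sides and summed.
  r₅ : + 1 * c₂ + + 4 * c₁ + + 4 * c₀ ≡ (X * X) * a₂ + + 2 * (X * X) * a₁ + (X * X) * a₀
  r₅ = trans
    (sym (transform-quadratic x (+ 1) (+ 4) (+ 4) (λ j → lhs (+ j) (a (2 ℕ.+ j))) n))
    (transform-quadratic x ((X * X)) (+ 2 * (X * X)) ((X * X))
      (λ j → trans (rec j) (rhs X (+ j) (a j))) n)
    where
    lhs : ∀ j y → ((+ 2 + j) * (+ 2 + j)) * y ≡ + 1 * (j * (j * y)) + + 4 * (j * y) + + 4 * y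
    lhs = solve-∀
    rhs : ∀ x j y → ((x * (+ 1 + j)) * (x * (+ 1 + j))) * y
      ≡ (x * x) * (j * (j * y)) + + 2 * (x * x) * (j * y) + (x * x) * y
    rhs = solve-∀

  -- The hypothesis on `a` with its index lowered by one, summed. At j = 0, where there is no lower
  -- index, `a₁≡0` takes its place.
  r₆ : (X * X) * d ≡ + 1 * b₂ + + 2 * b₁ + + 1 * b₀
  r₆ = trans (sym (trans
      (transform-linear x ((X * X)) (+ 0) {g = h} (λ j → pad ((X * X) * (+ j * h j)) (h j)) n)
      (sym (pad ((X * X) * d) (E h)))))
    (transform-quadratic x (+ 1) (+ 2) (+ 1) pointwise n)
    where
    pad : ∀ u v → u ≡ u + + 0 * v
    pad = solve-∀
    lhs : ∀ x j y → (x * x) * ((+ 1 + j) * ((+ 1 + j) * y)) ≡ ((x * (+ 1 + j)) * (x * (+ 1 + j))) * y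
    lhs = solve-∀
    rhs : ∀ j y → ((+ 2 + j) * (+ 2 + j)) * y
      ≡ + 1 * ((+ 1 + j) * ((+ 1 + j) * y)) + + 2 * ((+ 1 + j) * y) + + 1 * y
    rhs = solve-∀
    pointwise : ∀ j → (X * X) * (+ j * h j)
      ≡ + 1 * (+ j * (+ j * a (1 ℕ.+ j))) + + 2 * (+ j * a (1 ℕ.+ j)) + + 1 * a (1 ℕ.+ j)
    pointwise zero rewrite a₁≡0 = *-zeroʳ ((X * X))
    pointwise (suc j) = trans (lhs X (+ j) (a j)) (trans (sym (rec j)) (rhs (+ j) (a (2 ℕ.+ j))))

  combine : ℤ → ℤ → ℤ → ℤ → ℤ → ℤ → ℤ
  combine s₁ s₂ s₃ s₄ s₅ s₆ =
    (+ 2 + N) * s₁ + s₂ - X * (+ 1 + N) * s₃ - (X * X) * s₄ + s₅ - X * s₆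

  combine-cong : ∀ {s₁ s₂ s₃ s₄ s₅ s₆ t₁ t₂ t₃ t₄ t₅ t₆} →
    s₁ ≡ t₁ → s₂ ≡ t₂ → s₃ ≡ t₃ → s₄ ≡ t₄ → s₅ ≡ t₅ → s₆ ≡ t₆ →
    combine s₁ s₂ s₃ s₄ s₅ s₆ ≡ combine t₁ t₂ t₃ t₄ t₅ t₆
  combine-cong refl refl refl refl refl refl = refl

  vanish : ∀ n x → (+ 2 + n) * + 0 + + 0 - x * (+ 1 + n) * + 0 - (x * x) * + 0 + + 0 - x * + 0 ≡ + 0
  vanish = solve-∀

  combination : ∀ n x a₀ a₁ a₂ b₀ b₁ b₂ c₀ c₁ c₂ d →
    ((+ 2 + n) * (+ 2 + n)) * (x * (x * a₀ + b₀) + (x * b₀ + c₀))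
      - x * (+ 3 * ((+ 2 + n) * (+ 2 + n)) - + 3 * (+ 2 + n) + + 1) * (x * a₀ + b₀)
      + + 2 * (x * x) * ((+ 1 + n) * (+ 1 + n)) * a₀
    ≡ (+ 2 + n) * (n * c₀ - (c₁ + x * b₁))
      + (n * (+ 1 * c₁ + + 2 * c₀) - ((+ 1 * c₂ + + 2 * c₁) + x * (+ 1 * b₂ + + 1 * b₁)))
      - x * (+ 1 + n) * (n * b₀ - (b₁ + x * a₁))
      - (x * x) * (n * (+ 1 * a₁ + + 1 * a₀) - ((+ 1 * a₂ + + 1 * a₁) + x * d))
      + ((+ 1 * c₂ + + 4 * c₁ + + 4 * c₀) - ((x * x) * a₂ + + 2 * (x * x) * a₁ + (x * x) * a₀))
      - x * ((x * x) * d - (+ 1 * b₂ + + 2 * b₁ + + 1 * b₀))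
  combination = solve-∀

-- Congruences

infix 4 _≋_[mod_]

-- A record, unlike _≡_[mod_], lets Agda infer a and b from a congruence.
record _≋_[mod_] (a b : ℤ) (k : ℕ) : Set where
  constructor cong-mod
  field
    ∣difference : + k ∣ a - b

open _≋_[mod_]

mod-reflexive : ∀ {k a b} → a ≡ b → a ≋ b [mod k ]
mod-reflexive {k} {a} refl = cong-mod (subst (+ k ∣_) (sym (+-inverseʳ a)) (divides (+ 0) refl))

mod-refl : ∀ {k a} → a ≋ a [mod k ]
mod-refl = mod-reflexive refl

mod-trans : ∀ {k a b c} → a ≋ b [mod k ] → b ≋ c [mod k ] → a ≋ c [mod k ]
mod-trans {k} {a} {b} {c} (cong-mod p) (cong-mod q) =
  cong-mod (subst (+ k ∣_) (telescope a b c) (∣m∣n⇒∣m+n p q))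
  where
  telescope : ∀ a b c → (a - b) + (b - c) ≡ a - c
  telescope = solve-∀

mod-∣ : ∀ {k l a b} → k ℕ.∣ l → a ≋ b [mod l ] → a ≋ b [mod k ]
mod-∣ k∣l (cong-mod p) = cong-mod (∣-trans (∣ᵤ⇒∣ k∣l) p)

mod-+ : ∀ {k a b c d} → a ≋ b [mod k ] → c ≋ d [mod k ] → a + c ≋ b + d [mod k ]
mod-+ {k} {a} {b} {c} {d} (cong-mod p) (cong-mod q) =
  cong-mod (subst (+ k ∣_) (regroup a b c d) (∣m∣n⇒∣m+n p q))
  where
  regroup : ∀ a b c d → (a - b) + (c - d) ≡ (a + c) - (b + d)
  regroup = solve-∀

mod-* : ∀ {k a b c d} → a ≋ b [mod k ] → c ≋ d [mod k ] → a * c ≋ b * d [mod k ]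
mod-* {k} {a} {b} {c} {d} (cong-mod p) (cong-mod q) =
  cong-mod (subst (+ k ∣_) (regroup a b c d) (∣m∣n⇒∣m+n (∣m⇒∣m*n c p) (∣n⇒∣m*n b q)))
  where
  regroup : ∀ a b c d → (a - b) * c + b * (c - d) ≡ a * c - b * d
  regroup = solve-∀

-- Divisibility by prime powers

∤⇒^∣-cancel : ∀ {p} → Prime p → ∀ r {j c} → ¬ p ℕ.∣ j → p ℕ.^ r ℕ.∣ j ℕ.* c → p ℕ.^ r ℕ.∣ c
∤⇒^∣-cancel pp zero p∤j _ = ℕ.1∣ _
∤⇒^∣-cancel {p} pp (suc r) {j} {c} p∤j d
  with euclidsLemma j c pp (ℕ.∣-trans (ℕ.m∣m*n (p ℕ.^ r)) d)
... | inj₁ p∣j = contradiction p∣j p∤j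
... | inj₂ (ℕ.divides-refl c′) = subst (p ℕ.^ suc r ℕ.∣_) (ℕ.*-comm p c′)
  (ℕ.*-monoʳ-∣ p (∤⇒^∣-cancel pp r p∤j
    (ℕ.*-cancelˡ-∣ p ⦃ prime⇒nonZero pp ⦄ (subst (p ℕ.^ suc r ℕ.∣_) (swap j c′ p) d))))
  where
  swap : ∀ j c p → j ℕ.* (c ℕ.* p) ≡ p ℕ.* (j ℕ.* c)
  swap = ℕSolver.solve-∀

-- Factors of p are taken from j as long as it has any and the exponent lasts; once p ∤ j,
-- `∤⇒^∣-cancel` places all that remains in c.
^∣*-split : ∀ {p} → Prime p → ∀ r {j c} → p ℕ.^ r ℕ.∣ j ℕ.* c →
  ∃₂ λ s t → r ≡ t ℕ.+ s × p ℕ.^ s ℕ.∣ j × p ℕ.^ t ℕ.∣ c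
^∣*-split pp zero _ = 0 , 0 , refl , ℕ.1∣ _ , ℕ.1∣ _
^∣*-split {p} pp (suc r) {j} {c} d with p ℕ.∣? j
... | no p∤j = 0 , suc r , sym (ℕ.+-identityʳ _) , ℕ.1∣ _ , ∤⇒^∣-cancel pp (suc r) p∤j d
... | yes (ℕ.divides-refl j′) =
  let s , t , r≡ , d₁ , d₂ = ^∣*-split pp r {j′} {c}
        (ℕ.*-cancelˡ-∣ p ⦃ prime⇒nonZero pp ⦄ (subst (p ℕ.^ suc r ℕ.∣_) (swap j′ p c) d))
  in
  suc s , t , trans (cong suc r≡) (sym (ℕ.+-suc t s)) ,
  subst (p ℕ.^ suc s ℕ.∣_) (ℕ.*-comm p j′) (ℕ.*-monoʳ-∣ p d₁) , d₂
  where
  swap : ∀ j p c → j ℕ.* p ℕ.* c ≡ p ℕ.* (j ℕ.* c)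
  swap = ℕSolver.solve-∀

∤-* : ∀ {p} → Prime p → ∀ {a b} → ¬ + p ∣ a → ¬ + p ∣ b → ¬ + p ∣ a * b
∤-* {p} pp {a} {b} p∤a p∤b d
  with euclidsLemma ∣ a ∣ ∣ b ∣ pp (subst (p ℕ.∣_) (abs-* a b) (∣⇒∣ᵤ d))
... | inj₁ p∣a = p∤a (∣ᵤ⇒∣ p∣a)
... | inj₂ p∣b = p∤b (∣ᵤ⇒∣ p∣b)

∤⇒^∣-cancelℤ : ∀ {p} → Prime p → ∀ r {a b} → ¬ + p ∣ a → + (p ℕ.^ r) ∣ a * b → + (p ℕ.^ r) ∣ b
∤⇒^∣-cancelℤ {p} pp r {a} {b} p∤a d =
  ∣ᵤ⇒∣ (∤⇒^∣-cancel pp r {∣ a ∣} (p∤a ∘ ∣ᵤ⇒∣) (subst (p ℕ.^ r ℕ.∣_) (abs-* a b) (∣⇒∣ᵤ d)))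

-- Binomial coefficients

mutual
  -- This is (k+1) C(n, k+1) = (n-k) C(n, k) without subtraction. Pascal's rule derives the
  -- absorption identity for n + 1 from it, and two instances of absorption give it back for n + 1.
  [k+1]*nC[k+1]+k*nCk≡n*nCk : ∀ n k → suc k ℕ.* (n C suc k) ℕ.+ k ℕ.* (n C k) ≡ n ℕ.* (n C k)
  [k+1]*nC[k+1]+k*nCk≡n*nCk zero zero = refl
  [k+1]*nC[k+1]+k*nCk≡n*nCk zero (suc k)
    rewrite k>n⇒nCk≡0 {0} {suc (suc k)} (s≤s z≤n) | k>n⇒nCk≡0 {0} {suc k} (s≤s z≤n) =
    cong₂ ℕ._+_ (ℕ.*-zeroʳ k) (ℕ.*-zeroʳ k)
  [k+1]*nC[k+1]+k*nCk≡n*nCk (suc n) zero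
    rewrite nC1≡n (suc n) = trans (ℕ.+-identityʳ _) (ℕ.*-comm 1 (suc n))
  [k+1]*nC[k+1]+k*nCk≡n*nCk (suc n) (suc k) = begin
    suc (suc k) ℕ.* (suc n C suc (suc k)) ℕ.+ suc k ℕ.* (suc n C suc k)
      ≡⟨ cong₂ ℕ._+_ ([k+1]*[n+1]C[k+1]≡[n+1]*nCk n (suc k)) ([k+1]*[n+1]C[k+1]≡[n+1]*nCk n k) ⟩
    suc n ℕ.* (n C suc k) ℕ.+ suc n ℕ.* (n C k)
      ≡⟨ trans (sym (ℕ.*-distribˡ-+ (suc n) (n C suc k) (n C k)))
           (cong (suc n ℕ.*_) (ℕ.+-comm (n C suc k) (n C k))) ⟩
    suc n ℕ.* (n C k ℕ.+ n C suc k)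
      ≡⟨ cong (suc n ℕ.*_) (nCk+nC[k+1]≡[n+1]C[k+1] n k) ⟩
    suc n ℕ.* (suc n C suc k) ∎
    where open ≡-Reasoning

  [k+1]*[n+1]C[k+1]≡[n+1]*nCk : ∀ n k → suc k ℕ.* (suc n C suc k) ≡ suc n ℕ.* (n C k)
  [k+1]*[n+1]C[k+1]≡[n+1]*nCk n k = begin
    suc k ℕ.* (suc n C suc k)
      ≡⟨ cong (suc k ℕ.*_) (nCk+nC[k+1]≡[n+1]C[k+1] n k) ⟨
    suc k ℕ.* (n C k ℕ.+ n C suc k)
      ≡⟨ rearrange k (n C k) (n C suc k) ⟩
    n C k ℕ.+ (suc k ℕ.* (n C suc k) ℕ.+ k ℕ.* (n C k))
      ≡⟨ cong (n C k ℕ.+_) ([k+1]*nC[k+1]+k*nCk≡n*nCk n k) ⟩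
    suc n ℕ.* (n C k) ∎
    where
    open ≡-Reasoning
    rearrange : ∀ k a b → suc k ℕ.* (a ℕ.+ b) ≡ a ℕ.+ (suc k ℕ.* b ℕ.+ k ℕ.* a)
    rearrange = ℕSolver.solve-∀

n∣k*nCk : ∀ n k → n ℕ.∣ k ℕ.* (n C k)
n∣k*nCk n       zero    = n ℕ.∣0
n∣k*nCk zero    (suc k) rewrite k>n⇒nCk≡0 {0} {suc k} (s≤s z≤n) | ℕ.*-zeroʳ k = 0 ℕ.∣0
n∣k*nCk (suc n) (suc k) = subst (suc n ℕ.∣_) (sym ([k+1]*[n+1]C[k+1]≡[n+1]*nCk n k)) (ℕ.m∣m*n _)

-- p^r divides n, which divides k C(n, k), and the factor k is prime to p.
∤⇒^∣C : ∀ {p} → Prime p → ∀ r {n k} → p ℕ.^ r ℕ.∣ n → ¬ p ℕ.∣ k → p ℕ.^ r ℕ.∣ n C k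
∤⇒^∣C pp r {n} {k} d p∤k = ∤⇒^∣-cancel pp r p∤k (ℕ.∣-trans d (n∣k*nCk n k))

[k+1]*nC[k+1]≡[n-k]*nCk : ∀ n k → + suc k * + (n C suc k) ≡ (+ n - + k) * + (n C k)
[k+1]*nC[k+1]≡[n-k]*nCk n k = begin
  + suc k * + (n C suc k)
    ≡⟨ isolate (+ suc k * + (n C suc k)) (+ k * + (n C k)) ⟩
  (+ suc k * + (n C suc k) + + k * + (n C k)) - + k * + (n C k)
    ≡⟨ cong (_- + k * + (n C k)) (begin
      + suc k * + (n C suc k) + + k * + (n C k)
        ≡⟨ cong₂ _+_ (pos-* (suc k) (n C suc k)) (pos-* k (n C k)) ⟨
      + (suc k ℕ.* (n C suc k) ℕ.+ k ℕ.* (n C k))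
        ≡⟨ cong +_ ([k+1]*nC[k+1]+k*nCk≡n*nCk n k) ⟩
      + (n ℕ.* (n C k))
        ≡⟨ pos-* n (n C k) ⟩
      + n * + (n C k) ∎) ⟩
  + n * + (n C k) - + k * + (n C k)
    ≡⟨ factor (+ n) (+ k) (+ (n C k)) ⟩
  (+ n - + k) * + (n C k) ∎
  where
  open ≡-Reasoning
  isolate : ∀ u v → u ≡ (u + v) - v
  isolate = solve-∀
  factor : ∀ n k c → n * c - k * c ≡ (n - k) * c
  factor = solve-∀

-- Gauss congruences

Gauss : (ℕ → ℤ) → Set
Gauss f = ∀ {p} → Prime p → ∀ r n → p ℕ.^ r ℕ.∣ n → f (n ℕ.* p) ≋ f n [mod p ℕ.^ suc r ]

Gauss-cong : ∀ {f g : ℕ → ℤ} → (∀ n → f n ≡ g n) → Gauss f → Gauss g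
Gauss-cong eq gauss {p} pp r n d =
  subst₂ (λ u v → u ≋ v [mod p ℕ.^ suc r ]) (eq _) (eq _) (gauss pp r n d)

Gauss-* : ∀ {f g : ℕ → ℤ} → Gauss f → Gauss g → Gauss (λ n → f n * g n)
Gauss-* gf gg pp r n d = mod-* (gf pp r n d) (gg pp r n d)

-- If p^s is the exact power of p in k, with s ≤ r, then p^(r-s) divides n C k.
C*-Gauss : ∀ {f : ℕ → ℤ} → Gauss f → ∀ {p} → Prime p → ∀ r {n} k → p ℕ.^ r ℕ.∣ n →
  + (n C k) * f (k ℕ.* p) ≋ + (n C k) * f k [mod p ℕ.^ suc r ]
C*-Gauss {f} gauss {p} pp r {n} k d
  with s , t , refl , d₁ , d₂ ← ^∣*-split pp r {k} {n C k} (ℕ.∣-trans d (n∣k*nCk n k)) =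
  cong-mod (subst₂ _∣_
    (trans (sym (pos-* (p ℕ.^ t) (p ℕ.^ suc s)))
      (cong +_ (trans (sym (ℕ.^-distribˡ-+-* p t (suc s))) (cong (p ℕ.^_) (ℕ.+-suc t s)))))
    (distrib (+ (n C k)) (f (k ℕ.* p)) (f k))
    (∣-trans (*-monoˡ-∣ (+ (p ℕ.^ suc s)) {+ (p ℕ.^ t)} {+ (n C k)} (∣ᵤ⇒∣ d₂))
      (*-monoʳ-∣ (+ (n C k)) (∣difference (gauss pp s k d₁)))))
  where
  distrib : ∀ c x y → c * (x - y) ≡ c * x - c * y
  distrib = solve-∀

even⊎odd : ∀ n → (∃ λ k → n ≡ k ℕ.* 2) ⊎ (∃ λ k → n ≡ suc (k ℕ.* 2))
even⊎odd zero = inj₁ (0 , refl)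
even⊎odd (suc n) with even⊎odd n
... | inj₁ (k , refl) = inj₂ (k , refl)
... | inj₂ (k , refl) = inj₁ (suc k , refl)

2∤1+k*2 : ∀ k → ¬ 2 ℕ.∣ suc (k ℕ.* 2)
2∤1+k*2 k d with ℕ.∣1⇒≡1 (ℕ.∣m+n∣m⇒∣n (subst (2 ℕ.∣_) (ℕ.+-comm 1 (k ℕ.* 2)) d) (ℕ.n∣m*n k))
... | ()

-- The numbers n and np differ in parity only if n is odd and p = 2. Then p^r ∣ n forces r = 0, so a
-- congruence modulo p^(r+1) is only one modulo 2.
data Parities (p r n : ℕ) : Set where
  even  : ∀ k → n ≡ k ℕ.* 2 → Parities p r n
  odd   : ∀ k l → n ≡ suc (k ℕ.* 2) → n ℕ.* p ≡ suc (l ℕ.* 2) → Parities p r n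
  mixed : ∀ k → n ≡ suc (k ℕ.* 2) → p ≡ 2 → r ≡ 0 → Parities p r n

parities : ∀ {p} → Prime p → ∀ r n → p ℕ.^ r ℕ.∣ n → Parities p r n
parities {p} pp r n d with even⊎odd n | even⊎odd (n ℕ.* p)
... | inj₁ (k , eq)   | _ = even k eq
... | inj₂ (k , eq)   | inj₂ (l , eq′) = odd k l eq eq′
... | inj₂ (k , refl) | inj₁ (l , eq′)
  with euclidsLemma (suc (k ℕ.* 2)) p prime[2] (ℕ.divides l eq′)
... | inj₁ 2∣n = contradiction 2∣n (2∤1+k*2 k)
... | inj₂ 2∣p with prime⇒irreducible pp 2∣p
...   | inj₂ refl = mixed k refl refl (r≡0 r d)
  where
  r≡0 : ∀ r → 2 ℕ.^ r ℕ.∣ suc (k ℕ.* 2) → r ≡ 0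
  r≡0 zero    _ = refl
  r≡0 (suc r) d = contradiction (ℕ.∣-trans (ℕ.m∣m*n (2 ℕ.^ r)) d) (2∤1+k*2 k)

-1^[k*2]≡1 : ∀ k → -1ℤ ^ (k ℕ.* 2) ≡ + 1
-1^[k*2]≡1 k = begin
  -1ℤ ^ (k ℕ.* 2) ≡⟨ cong (-1ℤ ^_) (ℕ.*-comm k 2) ⟩
  -1ℤ ^ (2 ℕ.* k) ≡⟨ ^-*-assoc -1ℤ 2 k ⟨
  (+ 1) ^ k       ≡⟨ ^-zeroˡ k ⟩
  + 1             ∎
  where open ≡-Reasoning

*2*-comm : ∀ k p → k ℕ.* 2 ℕ.* p ≡ k ℕ.* p ℕ.* 2
*2*-comm = ℕSolver.solve-∀

Gauss-sign : Gauss (-1ℤ ^_)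
Gauss-sign {p} pp r n d with parities pp r n d
... | even k refl = mod-reflexive (trans (cong (-1ℤ ^_) (*2*-comm k p))
  (trans (-1^[k*2]≡1 (k ℕ.* p)) (sym (-1^[k*2]≡1 k))))
... | odd k l refl eq rewrite eq | -1^[k*2]≡1 k | -1^[k*2]≡1 l = mod-refl
-- The signs are 1 and -1, and their difference 2 is the modulus.
... | mixed k refl refl refl
  rewrite -1^[k*2]≡1 (suc (k ℕ.* 2)) | -1^[k*2]≡1 k = cong-mod (divides (+ 1) refl)

-- The congruence C(np, kp) ≡ C(n, k)

∏ : ℕ → (ℕ → ℤ) → ℤ
∏ zero    h = + 1
∏ (suc n) h = ∏ n h * h n

∏-cons : ∀ n h → ∏ (suc n) h ≡ h 0 * ∏ n (h ∘ suc)
∏-cons zero    h = *-comm (+ 1) (h 0)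
∏-cons (suc n) h = trans (cong (_* h (suc n)) (∏-cons n h)) (*-assoc (h 0) _ _)

∏-mod : ∀ {k} n {g h : ℕ → ℤ} → (∀ i → g i ≋ h i [mod k ]) → ∏ n g ≋ ∏ n h [mod k ]
∏-mod zero eq = mod-refl
∏-mod (suc n) eq = mod-* (∏-mod n eq) (eq n)

∏-scale : ∀ n c h → ∏ n (λ i → c * h i) ≡ c ^ n * ∏ n h
∏-scale zero c h = refl
∏-scale (suc n) c h = trans (cong (_* (c * h n)) (∏-scale n c h)) (regroup c (c ^ n) (∏ n h) (h n))
  where
  regroup : ∀ c d x y → d * x * (c * y) ≡ c * d * (x * y)
  regroup = solve-∀

∏-∤ : ∀ {p} → Prime p → ∀ n {h : ℕ → ℤ} → (∀ i → i ℕ.< n → ¬ + p ∣ h i) → ¬ + p ∣ ∏ n h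
∏-∤ pp zero _ d with refl ← ℕ.∣1⇒≡1 (∣⇒∣ᵤ d) = contradiction pp ¬prime[1]
∏-∤ pp (suc n) {h} p∤h =
  ∤-* pp {∏ n h} (∏-∤ pp n (λ i i<n → p∤h i (ℕ.m<n⇒m<1+n i<n))) (p∤h n ℕ.≤-refl)

-- Iterate (j+1) C(n, j+1) = (n-j) C(n, j) over j = k, ..., k+q-1.
C-∏ : ∀ n k q → + (n C (k ℕ.+ q)) * ∏ q (λ i → + suc (k ℕ.+ i))
              ≡ + (n C k) * ∏ q (λ i → + n - + (k ℕ.+ i))
C-∏ n k zero rewrite ℕ.+-identityʳ k = refl
C-∏ n k (suc q) rewrite ℕ.+-suc k q = begin
  + (n C suc (k ℕ.+ q)) * (R * + suc (k ℕ.+ q))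
    ≡⟨ regroup₁ (+ (n C suc (k ℕ.+ q))) R (+ suc (k ℕ.+ q)) ⟩
  + suc (k ℕ.+ q) * + (n C suc (k ℕ.+ q)) * R
    ≡⟨ cong (_* R) ([k+1]*nC[k+1]≡[n-k]*nCk n (k ℕ.+ q)) ⟩
  (+ n - + (k ℕ.+ q)) * + (n C (k ℕ.+ q)) * R
    ≡⟨ regroup₂ (+ n - + (k ℕ.+ q)) (+ (n C (k ℕ.+ q))) R ⟩
  + (n C (k ℕ.+ q)) * R * (+ n - + (k ℕ.+ q))
    ≡⟨ cong (_* (+ n - + (k ℕ.+ q))) (C-∏ n k q) ⟩
  + (n C k) * ∏ q (λ i → + n - + (k ℕ.+ i)) * (+ n - + (k ℕ.+ q))
    ≡⟨ *-assoc (+ (n C k)) _ _ ⟩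
  + (n C k) * (∏ q (λ i → + n - + (k ℕ.+ i)) * (+ n - + (k ℕ.+ q))) ∎
  where
  open ≡-Reasoning
  R : ℤ
  R = ∏ q (λ i → + suc (k ℕ.+ i))
  regroup₁ : ∀ c r y → c * (r * y) ≡ y * c * r
  regroup₁ = solve-∀
  regroup₂ : ∀ y c r → y * c * r ≡ c * r * y
  regroup₂ = solve-∀

-- Apart from its multiple of p, the t-th block of p factors in (kp)! and in np(np-1)⋯(np-kp+1)
-- is rising t and falling n t; the multiples of p together account for C(n, k).
module _ (q : ℕ) where
  private
    p : ℕ
    p = suc q

  rising : ℕ → ℤ
  rising t = ∏ q (λ i → + suc (t ℕ.* p ℕ.+ i))

  falling : ℕ → ℕ → ℤ
  falling n t = ∏ q (λ i → + (n ℕ.* p) - + (t ℕ.* p ℕ.+ suc i))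

  C-*p-∏ : ∀ n k → + ((n ℕ.* p) C (k ℕ.* p)) * ∏ k rising ≡ + (n C k) * ∏ k (falling n)
  C-*p-∏ n zero    = refl
  -- The factor p(k+1) is the multiple of p that `rising k` omits; with it the block has p
  -- consecutive factors and `C-∏` applies. On the other side the omitted factor is np - kp =
  -- p(n-k), and n - k turns C(n, k) into (k+1) C(n, k+1).
  C-*p-∏ n (suc k) = *-cancelˡ-≡ (+ p * + suc k) _ _ (begin
    + p * + suc k * (+ (np C (p ℕ.+ kp)) * (∏ k rising * rising k))
      ≡⟨ regroup₁ (+ p * + suc k) (+ (np C (p ℕ.+ kp))) (∏ k rising) (rising k) ⟩
    + (np C (p ℕ.+ kp)) * (rising k * (+ p * + suc k)) * ∏ k rising
      ≡⟨ cong (_* ∏ k rising) block ⟩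
    + (np C kp) * (+ p * (+ n - + k) * falling n k) * ∏ k rising
      ≡⟨ regroup₂ (+ p) (+ (np C kp)) (+ n - + k) (falling n k) (∏ k rising) ⟩
    + p * (+ n - + k) * falling n k * (+ (np C kp) * ∏ k rising)
      ≡⟨ cong (+ p * (+ n - + k) * falling n k *_) (C-*p-∏ n k) ⟩
    + p * (+ n - + k) * falling n k * (+ (n C k) * ∏ k (falling n))
      ≡⟨ regroup₃ (+ p) (+ n - + k) (+ (n C k)) (falling n k) (∏ k (falling n)) ⟩
    + p * ((+ n - + k) * + (n C k)) * (∏ k (falling n) * falling n k)
      ≡⟨ cong (λ u → + p * u * (∏ k (falling n) * falling n k)) ([k+1]*nC[k+1]≡[n-k]*nCk n k) ⟨
    + p * (+ suc k * + (n C suc k)) * (∏ k (falling n) * falling n k)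
      ≡⟨ regroup₄ (+ p) (+ suc k) (+ (n C suc k)) _ ⟩
    + p * + suc k * (+ (n C suc k) * (∏ k (falling n) * falling n k)) ∎)
    where
    open ≡-Reasoning
    np kp : ℕ
    np = n ℕ.* p
    kp = k ℕ.* p
    last-factor : ∀ k q → suc k ℕ.* suc q ≡ suc (k ℕ.* suc q ℕ.+ q)
    last-factor = ℕSolver.solve-∀
    first-factor : ∀ p n k → n * p - k * p ≡ p * (n - k)
    first-factor = solve-∀
    block : + (np C (p ℕ.+ kp)) * (rising k * (+ p * + suc k))
          ≡ + (np C kp) * (+ p * (+ n - + k) * falling n k)
    block = begin
      + (np C (p ℕ.+ kp)) * (rising k * (+ p * + suc k))
        ≡⟨ cong₂ (λ m u → + (np C m) * (rising k * u)) (ℕ.+-comm p kp)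
             (trans (*-comm (+ p) (+ suc k)) (trans (sym (pos-* (suc k) p)) (cong +_ (last-factor k q)))) ⟩
      + (np C (kp ℕ.+ p)) * (rising k * + suc (kp ℕ.+ q))
        ≡⟨ C-∏ np kp p ⟩
      + (np C kp) * ∏ p (λ i → + np - + (kp ℕ.+ i))
        ≡⟨ cong (+ (np C kp) *_) (∏-cons q _) ⟩
      + (np C kp) * ((+ np - + (kp ℕ.+ 0)) * falling n k)
        ≡⟨ cong (λ u → + (np C kp) * (u * falling n k))
             (trans (cong₂ (λ u v → u - v) (pos-* n p) (trans (cong +_ (ℕ.+-identityʳ kp)) (pos-* k p)))
               (first-factor (+ p) (+ n) (+ k))) ⟩
      + (np C kp) * (+ p * (+ n - + k) * falling n k) ∎
    regroup₁ : ∀ y c e b → y * (c * (e * b)) ≡ c * (b * y) * e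
    regroup₁ = solve-∀
    regroup₂ : ∀ p c y b e → c * (p * y * b) * e ≡ p * y * b * (c * e)
    regroup₂ = solve-∀
    regroup₃ : ∀ p y c b e → p * y * b * (c * e) ≡ p * (y * c) * (e * b)
    regroup₃ = solve-∀
    regroup₄ : ∀ p y c e → p * (y * c) * e ≡ p * y * (c * e)
    regroup₄ = solve-∀

  -- Each of the qk factors np - y is congruent to -y modulo np.
  falling≡±rising : ∀ n k → ∏ k (falling n) ≋ -1ℤ ^ (q ℕ.* k) * ∏ k rising [mod n ℕ.* p ]
  falling≡±rising n k = mod-trans
    (∏-mod k (λ t → mod-trans
      (∏-mod q (factor t))
      (mod-reflexive (∏-scale q -1ℤ _))))
    (mod-reflexive (trans (∏-scale k (-1ℤ ^ q) rising)
      (cong (_* ∏ k rising) (^-*-assoc -1ℤ q k))))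
    where
    cancel : ∀ x y → x - y - -1ℤ * y ≡ x
    cancel = solve-∀
    factor : ∀ t i → + (n ℕ.* p) - + (t ℕ.* p ℕ.+ suc i) ≋ -1ℤ * + suc (t ℕ.* p ℕ.+ i) [mod n ℕ.* p ]
    factor t i rewrite ℕ.+-suc (t ℕ.* p) i =
      cong-mod (∣-reflexive (sym (cancel (+ (n ℕ.* p)) (+ suc (t ℕ.* p ℕ.+ i)))))

  p∤rising : Prime p → ∀ t → ¬ + p ∣ rising t
  p∤rising pp t = ∏-∤ pp q λ i i<q d →
    ℕ.>⇒∤ (s≤s i<q) (ℕ.∣m+n∣m⇒∣n (subst (p ℕ.∣_) (sym (ℕ.+-suc (t ℕ.* p) i)) (∣⇒∣ᵤ d)) (ℕ.n∣m*n t))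

-- Reduce `C-*p-∏` modulo p^(r+1), which divides np: the product of `falling` becomes that of
-- `rising` up to sign. Once the sign is removed, the product of `rising`, being prime to p,
-- cancels.
C-*p : ∀ {p} → Prime p → ∀ r n k → p ℕ.^ r ℕ.∣ n →
  + ((n ℕ.* p) C (k ℕ.* p)) ≋ + (n C k) [mod p ℕ.^ suc r ]
C-*p {suc q} pp r n k d =
  cong-mod (∤⇒^∣-cancelℤ pp (suc r) (∏-∤ pp k (λ t _ → p∤rising q pp t))
    (subst (+ (p ℕ.^ suc r) ∣_) (factor (∏ k (rising q)) (+ ((n ℕ.* p) C (k ℕ.* p))) (+ (n C k)))
      (∣difference (mod-trans (mod-reflexive (C-*p-∏ q n k))
      (mod-trans
        (mod-* (mod-refl {a = + (n C k)}) (mod-∣ p^∣np (falling≡±rising q n k)))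
        unsign)))))
  where
  p : ℕ
  p = suc q
  factor : ∀ e a b → a * e - b * e ≡ e * (a - b)
  factor = solve-∀
  p^∣np : p ℕ.^ suc r ℕ.∣ n ℕ.* p
  p^∣np = subst (p ℕ.^ suc r ℕ.∣_) (ℕ.*-comm p n) (ℕ.*-monoʳ-∣ p d)
  σ : ℕ → ℤ
  σ = -1ℤ ^_
  σ² : σ k * σ k ≡ + 1
  σ² = trans (sym (^-distribˡ-+-* -1ℤ k k)) (trans (cong σ (double k)) (-1^[k*2]≡1 k))
    where
    double : ∀ k → k ℕ.+ k ≡ k ℕ.* 2
    double = ℕSolver.solve-∀
  -- Together with `σ²` this shows that multiplying by `σ k` turns `σ (k * p)` into `σ (q * k)` and
  -- `σ k` into 1. The Gauss property of the sign compares the former two, and `unsign` has to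
  -- compare the latter two.
  σ-*p : σ (k ℕ.* p) ≡ σ k * σ (q ℕ.* k)
  σ-*p = trans (cong σ (ℕ.*-comm k p)) (^-distribˡ-+-* -1ℤ k (q ℕ.* k))
  -- For p = 2 and k odd the sign is -1, but then 2^r ∣ C(n, k).
  unsign : + (n C k) * (σ (q ℕ.* k) * ∏ k (rising q)) ≋ + (n C k) * ∏ k (rising q) [mod p ℕ.^ suc r ]
  unsign = subst₂ (λ u v → u ≋ v [mod p ℕ.^ suc r ])
    (trans (cong (λ u → c * u * (σ k * e)) σ-*p)
      (trans (regroup₁ c (σ k) (σ (q ℕ.* k)) e) (drop-σ² (c * (σ (q ℕ.* k) * e)))))
    (trans (regroup₂ c (σ k) e) (drop-σ² (c * e)))
    (mod-* {c = σ k * e} (C*-Gauss Gauss-sign pp r k d) mod-refl)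
    where
    c e : ℤ
    c = + (n C k)
    e = ∏ k (rising q)
    drop-σ² : ∀ x → σ k * σ k * x ≡ x
    drop-σ² x = trans (cong (_* x) σ²) (*-identityˡ x)
    regroup₁ : ∀ c s u e → c * (s * u) * (s * e) ≡ s * s * (c * (u * e))
    regroup₁ = solve-∀
    regroup₂ : ∀ c s e → c * s * (s * e) ≡ s * s * (c * e)
    regroup₂ = solve-∀

-- Binomial sums modulo prime powers

∑ : ℕ → (ℕ → ℤ) → ℤ
∑ zero    h = + 0
∑ (suc n) h = h 0 + ∑ n (h ∘ suc)

∑-cong : ∀ n {g h : ℕ → ℤ} → (∀ i → g i ≡ h i) → ∑ n g ≡ ∑ n h
∑-cong zero    eq = refl
∑-cong (suc n) eq = cong₂ _+_ (eq 0) (∑-cong n (eq ∘ suc))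

∑-+ : ∀ n g h → ∑ n (λ i → g i + h i) ≡ ∑ n g + ∑ n h
∑-+ zero    g h = refl
∑-+ (suc n) g h = trans (cong (_+_ (g 0 + h 0)) (∑-+ n (g ∘ suc) (h ∘ suc)))
  (interchange (g 0) (h 0) _ _)
  where
  interchange : ∀ a b c d → (a + b) + (c + d) ≡ (a + c) + (b + d)
  interchange = solve-∀

∑-++ : ∀ m n h → ∑ (m ℕ.+ n) h ≡ ∑ m h + ∑ n (λ i → h (m ℕ.+ i))
∑-++ zero    n h = sym (+-identityˡ _)
∑-++ (suc m) n h = trans (cong (_+_ (h 0)) (∑-++ m n (h ∘ suc))) (sym (+-assoc (h 0) _ _))

∑-mod : ∀ {k} n {g h : ℕ → ℤ} → (∀ i → g i ≋ h i [mod k ]) → ∑ n g ≋ ∑ n h [mod k ]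
∑-mod zero    eq = mod-refl
∑-mod (suc n) eq = mod-+ (eq 0) (∑-mod n (eq ∘ suc))

∑-mod-zero : ∀ {k} n {h : ℕ → ℤ} → (∀ i → i ℕ.< n → h i ≋ + 0 [mod k ]) → ∑ n h ≋ + 0 [mod k ]
∑-mod-zero zero    eq = mod-refl
∑-mod-zero (suc n) eq = mod-+ (eq 0 (s≤s z≤n)) (∑-mod-zero n (λ i i<n → eq (suc i) (s≤s i<n)))

-- Cut the sum into m blocks of length p, each starting at a multiple of p: only the first term of a
-- block survives. Shifting `h` by p preserves the hypothesis.
∑-multiples : ∀ {k} p .⦃ _ : ℕ.NonZero p ⦄ m (h : ℕ → ℤ) → (∀ i → ¬ p ℕ.∣ i → h i ≋ + 0 [mod k ]) →
  ∑ (m ℕ.* p) h ≋ ∑ m (λ t → h (t ℕ.* p)) [mod k ]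
∑-multiples p zero h vanish = mod-refl
∑-multiples {k} p@(suc q) (suc m) h vanish = mod-trans
  (mod-reflexive (trans (∑-++ p (m ℕ.* p) h) (+-assoc (h 0) _ _)))
  (mod-+ (mod-refl {a = h 0}) (mod-trans
    (mod-+ (∑-mod-zero q (λ i i<q → vanish (suc i) (ℕ.>⇒∤ (s≤s i<q))))
      (∑-multiples p m (λ i → h (p ℕ.+ i)) (λ i p∤i → vanish (p ℕ.+ i) (p∤i ∘ λ d → ℕ.∣m+n∣m⇒∣n d ℕ.∣-refl))))
    (mod-reflexive (+-identityˡ _))))

-- Terms with j > n vanish, so the length N is left free. The induction uses two different lengths,
-- and so does the comparison of the sums for np and n.
transform-1 : ∀ f n N → n ℕ.< N → transform 1 f n ≡ ∑ N (λ j → + (n C j) * f j)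
transform-1 f zero (suc N) _ = begin
  f 0
    ≡⟨ pad (f 0) ⟩
  + 1 * f 0 + + 0
    ≡⟨ cong (_+_ (+ 1 * f 0)) (sym (zeros N (f ∘ suc))) ⟩
  + 1 * f 0 + ∑ N (λ j → + (0 C suc j) * f (suc j)) ∎
  where
  open ≡-Reasoning
  pad : ∀ a → a ≡ + 1 * a + + 0
  pad = solve-∀
  all-zero : ∀ n → ∑ n (λ _ → + 0) ≡ + 0
  all-zero zero    = refl
  all-zero (suc n) = trans (+-identityˡ _) (all-zero n)
  zeros : ∀ n g → ∑ n (λ j → + (0 C suc j) * g j) ≡ + 0
  zeros n g = trans
    (∑-cong n (λ j → cong (λ c → + c * g j) (k>n⇒nCk≡0 {0} {suc j} (s≤s z≤n))))
    (all-zero n)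
transform-1 f (suc n) (suc N) (s≤s n<N) = begin
  + 1 * transform 1 f n + transform 1 (f ∘ suc) n
    ≡⟨ cong₂ (λ u v → + 1 * u + v)
         (transform-1 f n (suc N) (ℕ.m<n⇒m<1+n n<N)) (transform-1 (f ∘ suc) n N n<N) ⟩
  + 1 * (+ 1 * f 0 + S₁) + S₀
    ≡⟨ rearrange (f 0) S₁ S₀ ⟩
  + 1 * f 0 + (S₀ + S₁)
    ≡⟨ cong (_+_ (+ 1 * f 0)) (sym (∑-+ N _ _)) ⟩
  + 1 * f 0 + ∑ N (λ j → + (n C j) * f (suc j) + + (n C suc j) * f (suc j))
    ≡⟨ cong (_+_ (+ 1 * f 0)) (∑-cong N λ j → trans
         (sym (*-distribʳ-+ (f (suc j)) (+ (n C j)) (+ (n C suc j))))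
         (cong (λ c → + c * f (suc j)) (nCk+nC[k+1]≡[n+1]C[k+1] n j))) ⟩
  + 1 * f 0 + ∑ N (λ j → + (suc n C suc j) * f (suc j)) ∎
  where
  open ≡-Reasoning
  S₀ S₁ : ℤ
  S₀ = ∑ N (λ j → + (n C j) * f (suc j))
  S₁ = ∑ N (λ j → + (n C suc j) * f (suc j))
  rearrange : ∀ a s₁ s₀ → + 1 * (+ 1 * a + s₁) + s₀ ≡ + 1 * a + (s₀ + s₁)
  rearrange = solve-∀

Gauss-transform-1 : ∀ {f} → Gauss f → Gauss (transform 1 f)
Gauss-transform-1 {f} gauss {p@(suc q)} pp r n d = mod-trans
  -- The length (n+1)p exceeds np and consists of whole blocks, so exactly the indices tp with t ≤ n
  -- remain.
  (mod-reflexive (transform-1 f (n ℕ.* p) (suc n ℕ.* p) (ℕ.m<n+m (n ℕ.* p) (s≤s z≤n))))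
  (mod-trans (∑-multiples p (suc n) _ vanish)
  (mod-trans (∑-mod (suc n) term)
    (mod-reflexive (sym (transform-1 f n (suc n) ℕ.≤-refl)))))
  where
  p^∣np : p ℕ.^ suc r ℕ.∣ n ℕ.* p
  p^∣np = subst (p ℕ.^ suc r ℕ.∣_) (ℕ.*-comm p n) (ℕ.*-monoʳ-∣ p d)
  vanish : ∀ j → ¬ p ℕ.∣ j → + ((n ℕ.* p) C j) * f j ≋ + 0 [mod p ℕ.^ suc r ]
  vanish j p∤j = cong-mod (subst (+ (p ℕ.^ suc r) ∣_) (sym (+-identityʳ _))
    (∣m⇒∣m*n (f j) (∣ᵤ⇒∣ {i = + ((n ℕ.* p) C j)} (∤⇒^∣C pp (suc r) {k = j} p^∣np p∤j))))
  term : ∀ t → + ((n ℕ.* p) C (t ℕ.* p)) * f (t ℕ.* p) ≋ + (n C t) * f t [mod p ℕ.^ suc r ]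
  term t = mod-trans (mod-* (C-*p pp r n t d) (mod-refl {a = f (t ℕ.* p)})) (C*-Gauss gauss pp r t d)

transform-0 : ∀ f n → transform 0 f n ≡ f n
transform-0 f zero    = refl
transform-0 f (suc n) = trans (+-identityˡ _) (transform-0 (f ∘ suc) n)

-- With E the shift operator, `transform x f n` is the value of (x + E)^n f at 0. Shifting n in
-- `transform x f` amounts to applying x + E to f, so 1 + E becomes 1 + x + E.
transform-suc : ∀ x f n → transform 1 (transform x f) n ≡ transform (suc x) f n
transform-suc x f zero = refl
transform-suc x f (suc n) = begin
  + 1 * T f + transform 1 (transform x f ∘ suc) n
    ≡⟨ cong (_+_ (+ 1 * T f)) (transform-linear 1 (+ x) (+ 1) (λ j → pad (+ x) (transform x f j) _) n) ⟩
  + 1 * T f + (+ x * T f + + 1 * T (f ∘ suc))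
    ≡⟨ collect (+ x) (T f) (T (f ∘ suc)) ⟩
  (+ 1 + + x) * T f + T (f ∘ suc)
    ≡⟨ cong₂ (λ u v → + suc x * u + v) (transform-suc x f n) (transform-suc x (f ∘ suc) n) ⟩
  + suc x * transform (suc x) f n + transform (suc x) (f ∘ suc) n ∎
  where
  open ≡-Reasoning
  T : (ℕ → ℤ) → ℤ
  T g = transform 1 (transform x g) n
  pad : ∀ x u v → x * u + v ≡ x * u + + 1 * v
  pad = solve-∀
  collect : ∀ x u v → + 1 * u + (x * u + + 1 * v) ≡ (+ 1 + x) * u + v
  collect = solve-∀

Gauss-transform : ∀ x {f} → Gauss f → Gauss (transform x f)
Gauss-transform zero    {f} gauss = Gauss-cong (λ n → sym (transform-0 f n)) gauss
Gauss-transform (suc x) {f} gauss = Gauss-cong (transform-suc x f) (Gauss-transform-1 (Gauss-transform x gauss))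

-- Central binomial coefficients

central : ℕ → ℤ
central k = + ((k ℕ.* 2) C k)

central-recurrence : ∀ k → + suc k * central (suc k) ≡ + 2 * + suc (k ℕ.* 2) * central k
central-recurrence k = begin
  + suc k * central (suc k)
    ≡⟨ pos-* (suc k) _ ⟨
  + (suc k ℕ.* (suc (suc (k ℕ.* 2)) C suc k))
    ≡⟨ cong +_ (begin
      suc k ℕ.* (suc n C suc k)      ≡⟨ [k+1]*[n+1]C[k+1]≡[n+1]*nCk n k ⟩
      suc n ℕ.* (n C k)              ≡⟨ pull k (n C k) ⟩
      2 ℕ.* (suc k ℕ.* (n C k))      ≡⟨ cong (2 ℕ.*_) symmetric ⟨
      2 ℕ.* (suc k ℕ.* (n C suc k))  ≡⟨ cong (2 ℕ.*_) ([k+1]*[n+1]C[k+1]≡[n+1]*nCk (k ℕ.* 2) k) ⟩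
      2 ℕ.* (n ℕ.* ((k ℕ.* 2) C k))  ≡⟨ ℕ.*-assoc 2 n ((k ℕ.* 2) C k) ⟨
      2 ℕ.* n ℕ.* ((k ℕ.* 2) C k)    ∎) ⟩
  + (2 ℕ.* n ℕ.* ((k ℕ.* 2) C k))
    ≡⟨ trans (pos-* (2 ℕ.* n) _) (cong (_* central k) (pos-* 2 n)) ⟩
  + 2 * + n * central k ∎
  where
  open ≡-Reasoning
  n : ℕ
  n = suc (k ℕ.* 2)
  pull : ∀ k c → suc (suc (k ℕ.* 2)) ℕ.* c ≡ 2 ℕ.* (suc k ℕ.* c)
  pull = ℕSolver.solve-∀
  split : ∀ k c → suc (k ℕ.* 2) ℕ.* c ≡ suc k ℕ.* c ℕ.+ k ℕ.* c
  split = ℕSolver.solve-∀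
  -- The symmetry C(2k+1, k+1) = C(2k+1, k), up to the factor k + 1 that the chain carries anyway.
  symmetric : suc k ℕ.* (n C suc k) ≡ suc k ℕ.* (n C k)
  symmetric = ℕ.+-cancelʳ-≡ (k ℕ.* (n C k)) _ _
    (trans ([k+1]*nC[k+1]+k*nCk≡n*nCk n k) (split k (n C k)))

-- The power of p is measured in the upper index 2k, as in `C-*p`; for p = 2 this is one more factor
-- than k has.
Gauss-central-even : ∀ {p} → Prime p → ∀ r k → p ℕ.^ r ℕ.∣ k ℕ.* 2 →
  central (k ℕ.* p) ≋ central k [mod p ℕ.^ suc r ]
Gauss-central-even {p} pp r k d =
  subst (λ m → + (m C (k ℕ.* p)) ≋ central k [mod p ℕ.^ suc r ]) (*2*-comm k p) (C-*p pp r (k ℕ.* 2) k d)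

-- `spread central` is the sequence u of constant terms of (z + 1/z)^j.
spread : (ℕ → ℤ) → ℕ → ℤ
spread f zero          = f 0
spread f (suc zero)    = + 0
spread f (suc (suc n)) = spread (f ∘ suc) n

spread-even : ∀ f k → spread f (k ℕ.* 2) ≡ f k
spread-even f zero    = refl
spread-even f (suc k) = spread-even (f ∘ suc) k

spread-odd : ∀ f k → spread f (suc (k ℕ.* 2)) ≡ + 0
spread-odd f zero    = refl
spread-odd f (suc k) = spread-odd (f ∘ suc) k

Gauss-spread-central : Gauss (spread central)
Gauss-spread-central {p} pp r n d with parities pp r n d
... | even k refl rewrite *2*-comm k p | spread-even central k | spread-even central (k ℕ.* p) =
  Gauss-central-even pp r k d
... | odd k l refl eq rewrite eq | spread-odd central k | spread-odd central l = mod-refl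
-- For n odd, u(n) = 0 and u(2n) = C(2n, n), which is even because 2 divides 2n but not n.
... | mixed k refl refl refl
  rewrite spread-odd central k | spread-even central (suc (k ℕ.* 2)) =
  cong-mod (subst (+ 2 ∣_) (sym (+-identityʳ (central (suc (k ℕ.* 2)))))
    (∣ᵤ⇒∣ {i = central (suc (k ℕ.* 2))} (∤⇒^∣C pp 1 {k = suc (k ℕ.* 2)} (ℕ.n∣m*n (suc (k ℕ.* 2))) (2∤1+k*2 k))))

spread-central-recurrence : ∀ j →
  (+ 2 + + j) * spread central (2 ℕ.+ j) ≡ + 4 * (+ 1 + + j) * spread central j
spread-central-recurrence j with even⊎odd j
... | inj₁ (k , refl) rewrite spread-even central k | spread-even (central ∘ suc) k = begin
  + (suc k ℕ.* 2) * central (suc k)   ≡⟨ cong (_* central (suc k)) (pos-* (suc k) 2) ⟩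
  + suc k * + 2 * central (suc k)     ≡⟨ swap (+ suc k) (central (suc k)) ⟩
  + 2 * (+ suc k * central (suc k))   ≡⟨ cong (_*_ (+ 2)) (central-recurrence k) ⟩
  + 2 * (+ 2 * + suc (k ℕ.* 2) * central k) ≡⟨ collect (+ suc (k ℕ.* 2)) (central k) ⟩
  + 4 * + suc (k ℕ.* 2) * central k ∎
  where
  open ≡-Reasoning
  swap : ∀ x c → x * + 2 * c ≡ + 2 * (x * c)
  swap = solve-∀
  collect : ∀ x c → + 2 * (+ 2 * x * c) ≡ + 4 * x * c
  collect = solve-∀
... | inj₂ (k , refl) rewrite spread-odd central k | spread-odd (central ∘ suc) k =
  trans (*-zeroʳ (+ suc (suc (suc (k ℕ.* 2))))) (sym (*-zeroʳ (+ 4 * + suc (suc (k ℕ.* 2)))))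

-- The coefficients 2^j u(j)²

2^ : ℕ → ℤ
2^ = transform 1 (λ _ → + 1)

coefficient : ℕ → ℤ
coefficient j = 2^ j * (spread central j * spread central j)

-- The powers of 2 are the binomial transform of the constant sequence 1, and `2^` is defined that
-- way so that `Gauss-transform-1` covers it.
Gauss-coefficient : Gauss coefficient
Gauss-coefficient =
  Gauss-* (Gauss-transform-1 (λ _ _ _ _ → mod-refl)) (Gauss-* Gauss-spread-central Gauss-spread-central)

-- Square the recurrence of u; the factor 4 from 2^(j+2) and the factor 4² combine to 8², the form
-- that `transform-recurrence` takes at x = 8.
coefficient-recurrence : ∀ j → (+ 2 + + j) * (+ 2 + + j) * coefficient (2 ℕ.+ j)
                             ≡ (+ 8 * (+ 1 + + j)) * (+ 8 * (+ 1 + + j)) * coefficient j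
coefficient-recurrence j = begin
  J₂ * J₂ * (2^ (2 ℕ.+ j) * (u₂ * u₂))
    ≡⟨ regroup₁ J₂ w u₂ ⟩
  + 4 * w * ((J₂ * u₂) * (J₂ * u₂))
    ≡⟨ cong (λ v → + 4 * w * (v * v)) (spread-central-recurrence j) ⟩
  + 4 * w * ((+ 4 * J₁ * u) * (+ 4 * J₁ * u))
    ≡⟨ regroup₂ J₁ w u ⟩
  (+ 8 * J₁) * (+ 8 * J₁) * (w * (u * u)) ∎
  where
  open ≡-Reasoning
  J₁ J₂ w u u₂ : ℤ
  J₁ = + 1 + + j
  J₂ = + 2 + + j
  w = 2^ j
  u = spread central j
  u₂ = spread central (2 ℕ.+ j)
  regroup₁ : ∀ x w y → x * x * ((+ 1 * (+ 1 * w + w) + (+ 1 * w + w)) * (y * y)) ≡ + 4 * w * ((x * y) * (x * y))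
  regroup₁ = solve-∀
  regroup₂ : ∀ x w y → + 4 * w * ((+ 4 * x * y) * (+ 4 * x * y)) ≡ (+ 8 * x) * (+ 8 * x) * (w * (y * y))
  regroup₂ = solve-∀

-- The Catalan-Larcombe-French numbers as a binomial transform

module _ {P : ℕ → ℤ} (isCLF : IsCatalanLarcombeFrench P) where
  open IsCatalanLarcombeFrench isCLF

  private
    Q : ℕ → ℤ
    Q = transform 8 coefficient

    step : ∀ n → P n ≡ Q n → P (1 ℕ.+ n) ≡ Q (1 ℕ.+ n) → P (2 ℕ.+ n) ≡ Q (2 ℕ.+ n)
    step n eq₀ eq₁ = *-cancelˡ-≡ (N * N) _ _ (begin
      N * N * P (2 ℕ.+ n)
        ≡⟨ isolate N (P (2 ℕ.+ n)) (P (1 ℕ.+ n)) (P n) ⟩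
      -- `N * (N * + 1)` is what `N ^ 2` unfolds to, so `recurrence` applies as it stands.
      (N * (N * + 1) * P (2 ℕ.+ n)
        - + 8 * (+ 3 * (N * (N * + 1)) - + 3 * N + + 1) * P (1 ℕ.+ n)
        + + 128 * ((N - + 1) * ((N - + 1) * + 1)) * P n) + remainder (P (1 ℕ.+ n)) (P n)
        ≡⟨ cong (_+ remainder (P (1 ℕ.+ n)) (P n)) (recurrence (2 ℕ.+ n) (s≤s (s≤s z≤n))) ⟩
      + 0 + remainder (P (1 ℕ.+ n)) (P n)
        ≡⟨ cong₂ (λ u v → + 0 + remainder u v) eq₁ eq₀ ⟩
      + 0 + remainder (Q (1 ℕ.+ n)) (Q n)
        -- At x = 8 the constants x and 2x² are 8 and 128; `refl` proves that the coefficient with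
        -- index 1 is 0, since u(1) = 0.
        ≡⟨ cong (_+ remainder (Q (1 ℕ.+ n)) (Q n))
             (transform-recurrence 8 coefficient refl coefficient-recurrence n) ⟨
      (N * N * Q (2 ℕ.+ n)
        - + 8 * (+ 3 * (N * N) - + 3 * N + + 1) * Q (1 ℕ.+ n)
        + + 2 * (+ 8 * + 8) * ((+ 1 + + n) * (+ 1 + + n)) * Q n) + remainder (Q (1 ℕ.+ n)) (Q n)
        ≡⟨ restore (+ n) (Q (2 ℕ.+ n)) (Q (1 ℕ.+ n)) (Q n) ⟩
      N * N * Q (2 ℕ.+ n) ∎)
      where
      open ≡-Reasoning
      N : ℤ
      N = + 2 + + n
      remainder : ℤ → ℤ → ℤ
      remainder u v = + 8 * (+ 3 * (N * N) - + 3 * N + + 1) * u - + 128 * ((N - + 1) * (N - + 1)) * v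
      isolate : ∀ n a b c → n * n * a ≡
        (n * (n * + 1) * a - + 8 * (+ 3 * (n * (n * + 1)) - + 3 * n + + 1) * b
          + + 128 * ((n - + 1) * ((n - + 1) * + 1)) * c)
        + (+ 8 * (+ 3 * (n * n) - + 3 * n + + 1) * b - + 128 * ((n - + 1) * (n - + 1)) * c)
      isolate = solve-∀
      restore : ∀ n a b c →
        ((+ 2 + n) * (+ 2 + n) * a - + 8 * (+ 3 * ((+ 2 + n) * (+ 2 + n)) - + 3 * (+ 2 + n) + + 1) * b
          + + 2 * (+ 8 * + 8) * ((+ 1 + n) * (+ 1 + n)) * c)
        + (+ 8 * (+ 3 * ((+ 2 + n) * (+ 2 + n)) - + 3 * (+ 2 + n) + + 1) * b
          - + 128 * ((+ 2 + n - + 1) * (+ 2 + n - + 1)) * c)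
        ≡ (+ 2 + n) * (+ 2 + n) * a
      restore = solve-∀

    consecutive : ∀ n → P n ≡ Q n × P (suc n) ≡ Q (suc n)
    -- `Q 0` and `Q 1` evaluate to 1 and 8.
    consecutive zero    = P₀≡1 , P₁≡8
    consecutive (suc n) with eq₀ , eq₁ ← consecutive n = eq₁ , step n eq₀ eq₁

  catalanLarcombeFrench : ∀ n → P n ≡ transform 8 coefficient n
  catalanLarcombeFrench n = proj₁ (consecutive n)

theorem3 : (P : ℕ → ℤ) → IsCatalanLarcombeFrench P →
    ∀ (p : ℕ) → Prime p →
    ∀ (m r : ℕ) → 1 ≤ m → 1 ≤ r →
    P (m ℕ.* p ℕ.^ r) ≡ P (m ℕ.* p ℕ.^ (r ∸ 1)) [mod p ℕ.^ r ]
theorem3 P isCLF p pp m (suc r) _ _ =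
  -- The Gauss property at n = m p^r, where r is now one less than the exponent in the statement.
  subst (λ n → P n ≡ P (m ℕ.* p ℕ.^ r) [mod p ℕ.^ suc r ])
    (trans (ℕ.*-assoc m (p ℕ.^ r) p) (cong (m ℕ.*_) (ℕ.*-comm (p ℕ.^ r) p)))
    (∣difference (Gauss-cong (λ n → sym (catalanLarcombeFrench isCLF n))
      (Gauss-transform 8 Gauss-coefficient) pp r (m ℕ.* p ℕ.^ r) (ℕ.n∣m*n m)))
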